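{- Let $G$ be a complete multipartite graph with parts $X_1, \ldots, X_r$. Then there exists an optimal strong geodetic set $S$ of $G$ such that for all but at most two indices $i \in \{1,\ldots,r\}$, the intersection $S \cap X_i$ is either empty or equal to $X_i$.
   Context: A complete multipartite graph with parts $X_1,\dots,X_r$ is the finite simple graph whose vertex set is the disjoint union of the nonempty sets $X_1,\dots,X_r$, in which two vertices are adjacent if and only if they lie in different parts. Let $G=(V,E)$ be a finite simple graph. For a set $S\subseteq V$ and for each pair of distinct vertices $\{x,y\}\subseteq S$, select one fixed shortest path $\widetilde{g}(x,y)$ between $x$ and $y$ in $G$. If the selection can be made so that the selected shortest paths (one per pair) together cover all vertices of $G$, i.e. the union of their vertex sets is $V$, then $S$ is called a strong geodetic set of $G$. If $G$ has just one vertex, that vertex is considered the unique strong geodetic set. The strong geodetic number $\mathrm{sg}(G)$ is the minimum size of a strong geodetic set of $G$; a strong geodetic set of size $\mathrm{sg}(G)$ is called an optimal strong geodetic set.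
   Formalization: The graph is assumed connected, which excludes only the case of a single part with at least two vertices: that graph has no edges, so no shortest paths between distinct vertices and no strong geodetic set exist, and the statement fails there. -}

module Defs where

open import Data.Nat using (ℕ; zero; suc; _≤_)
open import Data.Fin using (Fin; _<_)
open import Data.Fin.Subset using (Subset; _∈_; _∩_; ⊤; Nonempty; Empty; ∣_∣)
open import Data.List using (List; []; _∷_)
import Data.List.Membership.Propositional as List
open import Data.List.Relation.Unary.Unique.Propositional using (Unique)
open import Data.Product using (Σ; _×_; _,_; ∃; ∃-syntax; proj₁)
open import Data.Sum using (_⊎_)
open import Function.Bundles using (_⇔_)
open import Relation.Binary.Core using (Rel)
open import Relation.Binary.Definitions using (Symmetric; Decidable)
open import Relation.Binary.Construct.Closure.ReflexiveTransitive using (Star; ε; _◅_)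
open import Relation.Binary.PropositionalEquality using (_≡_; _≢_)
open import Relation.Nullary using (¬_)
import Level

record Graph (n : ℕ) : Set₁ where
  field
    Adj         : Rel (Fin n) Level.zero
    adj?        : Decidable Adj
    adj-sym     : Symmetric Adj
    adj-irrefl  : ∀ {v} → ¬ Adj v v

open Graph public

module _ {n : ℕ} (G : Graph n) where

  Walk : Fin n → Fin n → Set
  Walk = Star (Adj G)

  length : ∀ {x y} → Walk x y → ℕ
  length ε       = zero
  length (_ ◅ w) = suc (length w)

  vertices : ∀ {x y} → Walk x y → List (Fin n)
  vertices {x} ε       = x ∷ []
  vertices {x} (_ ◅ w) = x ∷ vertices w

  IsPath : ∀ {x y} → Walk x y → Set
  IsPath w = Unique (vertices w)

  IsShortestPath : ∀ {x y} → Walk x y → Set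
  IsShortestPath {x} {y} p =
    IsPath p × (∀ (q : Walk x y) → IsPath q → length p ≤ length q)

  ShortestPath : Fin n → Fin n → Set
  ShortestPath x y = Σ (Walk x y) IsShortestPath

  Connected : Set
  Connected = ∀ x y → Walk x y

  -- An unordered pair {x , y} of distinct vertices is represented once, by its
  -- ordering x < y.  The proofs of x < y, x ∈ S and y ∈ S are unique, so a
  -- selection picks exactly one path per pair.
  Selection : Subset n → Set
  Selection S = ∀ {x y} → x < y → x ∈ S → y ∈ S → ShortestPath x y

  Covers : (S : Subset n) → Selection S → Set
  Covers S g =
    ∀ v → ∃[ x ] ∃[ y ] Σ (x < y) λ x<y → Σ (x ∈ S) λ x∈S → Σ (y ∈ S) λ y∈S →
      v List.∈ vertices (proj₁ (g x<y x∈S y∈S))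

  -- The first alternative is the convention for the one-vertex graph; there
  -- are no pairs in that case, so it is then the only possible alternative.
  IsStrongGeodetic : Subset n → Set
  IsStrongGeodetic S = (n ≡ 1 × S ≡ ⊤) ⊎ Σ (Selection S) (Covers S)

  -- sg(G) = k, as a relation.
  IsStrongGeodeticNumber : ℕ → Set
  IsStrongGeodeticNumber k =
    (∃[ S ] (IsStrongGeodetic S × ∣ S ∣ ≡ k)) ×
    (∀ T → IsStrongGeodetic T → k ≤ ∣ T ∣)

  IsOptimalStrongGeodetic : Subset n → Set
  IsOptimalStrongGeodetic S =
    IsStrongGeodetic S × IsStrongGeodeticNumber ∣ S ∣

  record IsCompleteMultipartite {r : ℕ} (X : Fin r → Subset n) : Set where
    field
      nonempty : ∀ i → Nonempty (X i)
      disjoint : ∀ {i j} → i ≢ j → Empty (X i ∩ X j)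
      covering : ∀ v → ∃[ i ] v ∈ X i
      adjacent : ∀ {i j u v} → u ∈ X i → v ∈ X j → Adj G u v ⇔ i ≢ j

ForAllButAtMost : ℕ → ∀ {r} → (Fin r → Set) → Set
ForAllButAtMost k {r} P =
  ∃[ B ] (∣ B ∣ ≤ k × (∀ (i : Fin r) → ¬ i ∈ B → P i))

{-# OPTIONS --safe #-}
module Submission where

-- Let sᵢ and dᵢ be the numbers of vertices of Xᵢ inside and outside S, and let
-- P = Σ C(sᵢ, 2).  Only a pair within some Xⱼ covers anything besides its ends,
-- namely one freely chosen vertex outside Xⱼ, so by Hall's theorem a set S of at
-- least two vertices is strong geodetic iff Σ dᵢ ≤ P and dᵢ + C(sᵢ, 2) ≤ P for
-- all i.  Among the smallest such S take one with P maximal.  If three parts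
-- were properly split, moving a vertex of S out of the one with the smallest sᵢ
-- into one of the other two would keep these inequalities and increase P: the
-- condition can only break for the receiving part, and it cannot break for both
-- candidates.

open import Defs
open import Data.Nat using (ℕ; zero; suc; _+_; _∸_; _≤_; _<_; z≤n; s≤s; z<s; s<s; _≤?_; _<?_)
import Data.Nat as ℕ
import Data.Nat.Properties as ℕ
open import Data.Nat.Induction using (<-wellFounded)
open import Data.Nat.Solver using (module +-*-Solver)
open import Data.Fin using (Fin; zero; suc; _≟_)
import Data.Fin as Fin
import Data.Fin.Properties as Fin
open import Data.Fin.Subset using (Subset; Empty; _∩_; _∪_; _-_; ∁; ⁅_⁆; ∣_∣; ⊤; inside; outside)
import Data.Fin.Subset as Subset
open import Data.Fin.Subset.Properties
open import Data.List using (List; []; _∷_; _++_; filter; map)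
import Data.List as List
import Data.List.Properties as List
open import Data.List.Membership.Propositional using (_∈_; _∉_; find)
open import Data.List.Membership.Propositional.Properties
open import Data.List.Membership.Propositional.Properties.WithK using (unique∧set⇒bag)
open import Data.List.Relation.Binary.BagAndSetEquality using (∼bag⇒↭)
open import Data.List.Relation.Binary.Permutation.Propositional
  using (_↭_; ↭-refl; ↭-sym; ↭-trans; refl; prep; swap)
import Data.List.Relation.Binary.Permutation.Propositional as Permutation
import Data.List.Relation.Binary.Permutation.Setoid.Properties as SetoidPermutation
open import Data.List.Relation.Binary.Permutation.Propositional.Properties
  using (↭-length; filter-↭; ∈-resp-↭; All-resp-↭; shift; ++⁺ʳ; ++⁺ˡ)
  renaming (map⁺ to ↭-map⁺)
open import Data.List.Relation.Unary.All using (All; []; _∷_)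
import Data.List.Relation.Unary.All as All
import Data.List.Relation.Unary.All.Properties as All
open import Data.List.Relation.Unary.Any using (here; there; any?)
import Data.List.Relation.Unary.Any as Any
open import Data.List.Relation.Unary.AllPairs using (AllPairs; []; _∷_)
import Data.List.Relation.Unary.AllPairs as AllPairs
import Data.List.Relation.Unary.AllPairs.Properties as AllPairs
open import Data.List.Relation.Unary.Unique.Propositional using (Unique)
import Data.List.Relation.Unary.Unique.Propositional.Properties as Unique
open import Data.Product using (_×_; _,_; Σ; ∃; ∃₂; ∃-syntax; proj₁; proj₂)
open import Data.Product.Properties using (≡-dec)
open import Data.Sum using (_⊎_; inj₁; inj₂)
open import Data.Vec using ([]; _∷_; here; there; tabulate)
open import Data.Vec.Properties using (lookup⇒[]=; []=⇒lookup; lookup∘tabulate)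
open import Data.Vec.Properties.WithK using ([]=-irrelevant)
open import Function using (_∘_; case_of_)
open import Function.Bundles using (_⇔_; mk⇔; Equivalence)
open import Induction.WellFounded using (Acc; acc)
open import Relation.Binary.Construct.Closure.ReflexiveTransitive using (ε; _◅_)
open import Relation.Binary.PropositionalEquality
  using (_≡_; _≢_; refl; sym; trans; cong; cong₂; subst; subst₂; ≢-sym; setoid; module ≡-Reasoning)
open import Relation.Binary.Definitions using (tri<; tri≈; tri>)
open import Relation.Nullary using (¬_; Dec; does; yes; no; contradiction; ¬?; _×-dec_)
open import Relation.Nullary.Decidable using (decidable-stable; dec-true; dec-false)
open import Relation.Unary using (Decidable)

-- Lists coloured by a finite set

module _ {r : ℕ} {A : Set} (f : A → Fin r) where

  count : Fin r → List A → ℕ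
  count i xs = List.length (filter (λ x → f x ≟ i) xs)

  countNot : Fin r → List A → ℕ
  countNot i xs = List.length (filter (λ x → ¬? (f x ≟ i)) xs)

  count-∷-≡ : ∀ {i x} xs → f x ≡ i → count i (x ∷ xs) ≡ suc (count i xs)
  count-∷-≡ {i} xs eq = cong List.length (List.filter-accept (λ x → f x ≟ i) {xs = xs} eq)

  count-∷-≢ : ∀ {i x} xs → f x ≢ i → count i (x ∷ xs) ≡ count i xs
  count-∷-≢ {i} xs neq = cong List.length (List.filter-reject (λ x → f x ≟ i) {xs = xs} neq)

  count-∷-≤ : ∀ i x xs → count i xs ≤ count i (x ∷ xs)
  count-∷-≤ i x xs with f x ≟ i
  ... | yes _ = ℕ.n≤1+n _
  ... | no  _ = ℕ.≤-refl

  count+countNot≡length : ∀ i xs → count i xs + countNot i xs ≡ List.length xs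
  count+countNot≡length i []       = refl
  count+countNot≡length i (x ∷ xs) with f x ≟ i
  ... | yes _ = cong suc (count+countNot≡length i xs)
  ... | no  _ = trans (ℕ.+-suc _ _) (cong suc (count+countNot≡length i xs))

  count-↭ : ∀ {xs ys} i → xs ↭ ys → count i xs ≡ count i ys
  count-↭ i p = ↭-length (filter-↭ (λ x → f x ≟ i) p)

  countNot-↭ : ∀ {xs ys} i → xs ↭ ys → countNot i xs ≡ countNot i ys
  countNot-↭ i p = ↭-length (filter-↭ (λ x → ¬? (f x ≟ i)) p)

  -- An element has one colour, so it contributes to at most one of the three terms. `balanced-room`
  -- needs this both for the outside vertices and for the monochromatic pairs.
  count-three : ∀ {i j k} → i ≢ j → i ≢ k → j ≢ k → ∀ xs →
                count i xs + count j xs + count k xs ≤ List.length xs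
  count-three i≢j i≢k j≢k [] = z≤n
  count-three {i} {j} {k} i≢j i≢k j≢k (x ∷ xs)
    with count-three i≢j i≢k j≢k xs | f x ≟ i | f x ≟ j | f x ≟ k
  ... | ih | yes refl | yes refl | _        = contradiction refl i≢j
  ... | ih | yes refl | no _     | yes refl = contradiction refl i≢k
  ... | ih | no _     | yes refl | yes refl = contradiction refl j≢k
  ... | ih | yes refl | no _     | no _     = s≤s ih
  ... | ih | no _     | yes refl | no _     =
    subst (_≤ suc (List.length xs)) (sym (cong (_+ count k xs) (ℕ.+-suc (count i xs) (count j xs)))) (s≤s ih)
  ... | ih | no _     | no _     | yes refl = subst (_≤ suc (List.length xs)) (sym (ℕ.+-suc _ _)) (s≤s ih)
  ... | ih | no _     | no _     | no _     = ℕ.m≤n⇒m≤1+n ih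

∈⇒↭ : ∀ {A : Set} {x : A} {xs} → x ∈ xs → ∃[ ys ] xs ↭ x ∷ ys
∈⇒↭ x∈xs with ys , zs , refl ← ∈-∃++ x∈xs = ys ++ zs , shift _ ys zs

-- Matching two coloured lists along unequal colours

module _ {r : ℕ} {A B : Set} (f : A → Fin r) (g : B → Fin r) where

  -- Every element of `as` is matched. The unmatched rest `free` of `bs` is kept as data because the
  -- augmentation in `match` draws on it.
  Matching : List A → List B → Set
  Matching as bs = ∃₂ λ (ms : List (A × B)) (free : List B) →
    map proj₁ ms ↭ as × map proj₂ ms ++ free ↭ bs × All (λ (a , b) → f a ≢ g b) ms

  -- If no matched pair avoids colour `i` on both sides, a partner without colour `i` belongs to an
  -- `a` with colour `i`. This is the situation in which `match` could get stuck.
  countNot-partners : ∀ i (ms : List (A × B)) →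
    All (λ (a , b) → f a ≢ g b) ms → All (λ (a , b) → ¬ (f a ≢ i × g b ≢ i)) ms →
    countNot g i (map proj₂ ms) ≤ count f i (map proj₁ ms)
  countNot-partners i []             _          _          = z≤n
  countNot-partners i ((a , b) ∷ ms) (d ∷ ds) (q ∷ qs)
    with countNot-partners i ms ds qs | f a ≟ i | g b ≟ i
  ... | ih | yes _   | yes _   = ℕ.m≤n⇒m≤1+n ih
  ... | ih | yes _   | no _    = s≤s ih
  ... | ih | no _    | yes _   = ih
  ... | ih | no fa≢i | no gb≢i = contradiction (fa≢i , gb≢i) q

  countNot-++-≡ : ∀ i bs {free} → All (λ b → g b ≡ i) free →
                  countNot g i (bs ++ free) ≡ countNot g i bs
  countNot-++-≡ i bs {free} free≡i = cong List.length (begin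
    filter P? (bs ++ free)           ≡⟨ List.filter-++ P? bs free ⟩
    filter P? bs ++ filter P? free   ≡⟨ cong (filter P? bs ++_)
                                          (List.filter-none P? (All.map (λ eq neq → neq eq) free≡i)) ⟩
    filter P? bs ++ []               ≡⟨ List.++-identityʳ _ ⟩
    filter P? bs                     ∎)
    where
    open ≡-Reasoning
    P? : Decidable (λ b → g b ≢ i)
    P? b = ¬? (g b ≟ i)

  free-nonempty : ∀ {as bs} (ms : List (A × B)) (free : List B) → map proj₁ ms ↭ as → map proj₂ ms ++ free ↭ bs →
                  List.length as < List.length bs → Σ B λ b → Σ (List B) λ free′ → free ≡ b ∷ free′
  free-nonempty ms (b ∷ free) _ _ _ = b , free , refl
  free-nonempty {as = as} {bs} ms [] ms↭as ms↭bs as<bs = contradiction as<bs (ℕ.<-irrefl (begin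
    List.length as                        ≡⟨ ↭-length ms↭as ⟨
    List.length (map proj₁ ms)            ≡⟨ List.length-map proj₁ ms ⟩
    List.length ms                        ≡⟨ List.length-map proj₂ ms ⟨
    List.length (map proj₂ ms)            ≡⟨ cong List.length (List.++-identityʳ (map proj₂ ms)) ⟨
    List.length (map proj₂ ms ++ [])      ≡⟨ ↭-length ms↭bs ⟩
    List.length bs                        ∎))
    where open ≡-Reasoning

  -- The conditions are Hall's: a set of elements of as with two different
  -- colours can be matched to everything.  The proof adds one element a of
  -- colour i at a time; if all free b have colour i too, then a takes over the
  -- partner of some a′ ≢ i with partner ≢ i, and a′ gets a free element.
  match : ∀ as bs → List.length as ≤ List.length bs →
          (∀ i → count f i as ≤ countNot g i bs) → Matching as bs
  match []       bs _     _    = [] , bs , ↭-refl , ↭-refl , []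
  match (a ∷ as) bs as<bs hall
    with match as bs (ℕ.<⇒≤ as<bs) (λ i → ℕ.≤-trans (count-∷-≤ f i a as) (hall i))
  ... | ms , free , ms↭as , ms↭bs , ds with any? (λ b → ¬? (f a ≟ g b)) free
  ... | yes q with b , b∈free , fa≢gb ← find q with free′ , free↭ ← ∈⇒↭ b∈free =
    (a , b) ∷ ms , free′ , prep a ms↭as ,
    ↭-trans (↭-sym (shift b (map proj₂ ms) free′))
            (↭-trans (++⁺ˡ (map proj₂ ms) (↭-sym free↭)) ms↭bs) ,
    fa≢gb ∷ ds
  ... | no ¬q with any? (λ (a′ , b′) → ¬? (f a′ ≟ f a) ×-dec ¬? (g b′ ≟ f a)) ms
  ... | yes q with (a′ , b′) , m∈ms , fa′≢fa , gb′≢fa ← find q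
              with ms′ , ms↭ ← ∈⇒↭ m∈ms
              with b , free′ , refl ← free-nonempty ms free ms↭as ms↭bs as<bs =
    (a , b′) ∷ (a′ , b) ∷ ms′ , free′ ,
    prep a (↭-trans (↭-sym (↭-map⁺ proj₁ ms↭)) ms↭as) ,
    ↭-trans (prep b′ (↭-sym (shift b (map proj₂ ms′) free′)))
            (↭-trans (++⁺ʳ (b ∷ free′) (↭-sym (↭-map⁺ proj₂ ms↭))) ms↭bs) ,
    ≢-sym gb′≢fa ∷ (λ fa′≡gb → fa′≢fa (trans fa′≡gb gb≡fa)) ∷ All.tail (All-resp-↭ ms↭ ds)
    where
    gb≡fa : g b ≡ f a
    gb≡fa = decidable-stable (g b ≟ f a) (λ gb≢fa → ¬q (here (≢-sym gb≢fa)))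
  -- Neither move is possible: all free elements, and one side of every matched pair, have colour
  -- `f a`. Then at most `count f (f a) as` elements of `bs` avoid this colour, too few for
  -- `hall (f a)`.
  match (a ∷ as) bs as<bs hall
      | ms , free , ms↭as , ms↭bs , ds | no ¬q | no ¬q′ =
    contradiction (hall (f a)) (ℕ.<⇒≱ (begin-strict
      countNot g (f a) bs                     ≡⟨ countNot-↭ g (f a) ms↭bs ⟨
      countNot g (f a) (map proj₂ ms ++ free) ≡⟨ countNot-++-≡ (f a) (map proj₂ ms) free≡fa ⟩
      countNot g (f a) (map proj₂ ms)         ≤⟨ countNot-partners (f a) ms ds (All.¬Any⇒All¬ ms ¬q′) ⟩
      count f (f a) (map proj₁ ms)            ≡⟨ count-↭ f (f a) ms↭as ⟩
      count f (f a) as                        <⟨ ℕ.n<1+n _ ⟩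
      suc (count f (f a) as)                  ≡⟨ count-∷-≡ f as refl ⟨
      count f (f a) (a ∷ as)                  ∎))
    where
    open ℕ.≤-Reasoning
    free≡fa : All (λ b → g b ≡ f a) free
    free≡fa = All.map (λ {b} ¬fa≢gb → sym (decidable-stable (f a ≟ g b) ¬fa≢gb))
                      (All.¬Any⇒All¬ free ¬q)

-- The `b` found for the first element is deleted from `bs`; by `inj` and uniqueness no later
-- element is related to it, so the rest still finds its partners.
injection⇒length-≤ : ∀ {A B : Set} (R : A → B → Set) → (∀ {a a′ b} → R a b → R a′ b → a ≡ a′) →
  ∀ {as} → Unique as → ∀ bs → (∀ {a} → a ∈ as → ∃[ b ] b ∈ bs × R a b) →
  List.length as ≤ List.length bs
injection⇒length-≤ R inj []           bs total = z≤n
injection⇒length-≤ R inj (a≢as ∷ as!) bs total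
  with b , b∈bs , Rab ← total (here refl) with bs′ , bs↭ ← ∈⇒↭ b∈bs =
  subst (_ ≤_) (sym (↭-length bs↭)) (s≤s (injection⇒length-≤ R inj as! bs′ total′))
  where
  total′ : ∀ {a′} → a′ ∈ _ → ∃[ b′ ] b′ ∈ bs′ × R a′ b′
  total′ a′∈as with total (there a′∈as)
  ... | b′ , b′∈bs , Ra′b′ with ∈-resp-↭ bs↭ b′∈bs
  ...   | here refl   = contradiction (inj Rab Ra′b′) (All.lookup a≢as a′∈as)
  ...   | there b′∈bs′ = b′ , b′∈bs′ , Ra′b′

-- Monochromatic pairs

-- The binomial coefficient C(k, 2): a new element forms `k` pairs with the `k` old ones.
triangle : ℕ → ℕ
triangle zero    = zero
triangle (suc k) = k + triangle k

n≤1+triangle : ∀ k → k ≤ suc (triangle k)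
n≤1+triangle zero    = z≤n
n≤1+triangle (suc k) = s≤s (ℕ.m≤m+n k (triangle k))

module _ {r : ℕ} {A : Set} (c : A → Fin r) where

  -- Each pair is listed once, with the earlier entry first. On a sorted list this is the order
  -- `x < y` that indexes a `Selection`.
  monoPairs : List A → List (A × A)
  monoPairs []       = []
  monoPairs (x ∷ xs) = map (x ,_) (filter (λ y → c y ≟ c x) xs) ++ monoPairs xs

  #monoPairs : List A → ℕ
  #monoPairs xs = List.length (monoPairs xs)

  #monoPairs-∷ : ∀ x xs → #monoPairs (x ∷ xs) ≡ count c (c x) xs + #monoPairs xs
  #monoPairs-∷ x xs = trans (List.length-++ (map (x ,_) (filter _ xs)))
                            (cong (_+ #monoPairs xs) (List.length-map _ (filter _ xs)))

  #monoPairs-↭ : ∀ {xs ys} → xs ↭ ys → #monoPairs xs ≡ #monoPairs ys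
  #monoPairs-↭ refl                 = refl
  #monoPairs-↭ (prep {xs} {ys} x p) = begin
    #monoPairs (x ∷ xs)             ≡⟨ #monoPairs-∷ x xs ⟩
    count c (c x) xs + #monoPairs xs ≡⟨ cong₂ _+_ (count-↭ c (c x) p) (#monoPairs-↭ p) ⟩
    count c (c x) ys + #monoPairs ys ≡⟨ #monoPairs-∷ x ys ⟨
    #monoPairs (x ∷ ys)             ∎
    where open ≡-Reasoning
  #monoPairs-↭ (Permutation.trans p q) = trans (#monoPairs-↭ p) (#monoPairs-↭ q)
  #monoPairs-↭ (swap {xs} {ys} x y p) = begin
    #monoPairs (x ∷ y ∷ xs)                                      ≡⟨ expand x y xs ⟩
    count c (c x) (y ∷ xs) + (count c (c y) xs + #monoPairs xs)  ≡⟨ exchange ⟩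
    count c (c y) (x ∷ xs) + (count c (c x) xs + #monoPairs xs)
      ≡⟨ cong₂ _+_ (count-↭ c (c y) (prep x p)) (cong₂ _+_ (count-↭ c (c x) p) (#monoPairs-↭ p)) ⟩
    count c (c y) (x ∷ ys) + (count c (c x) ys + #monoPairs ys)  ≡⟨ expand y x ys ⟨
    #monoPairs (y ∷ x ∷ ys)                                      ∎
    where
    open ≡-Reasoning
    expand : ∀ x y zs → #monoPairs (x ∷ y ∷ zs) ≡
                        count c (c x) (y ∷ zs) + (count c (c y) zs + #monoPairs zs)
    expand x y zs = trans (#monoPairs-∷ x (y ∷ zs)) (cong (count c (c x) (y ∷ zs) +_) (#monoPairs-∷ y zs))
    -- The pair formed by `x` and `y` is counted at whichever of them stands first, on both sides or
    -- on neither, according to whether their colours agree.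
    exchange : count c (c x) (y ∷ xs) + (count c (c y) xs + #monoPairs xs) ≡
               count c (c y) (x ∷ xs) + (count c (c x) xs + #monoPairs xs)
    exchange with c x ≟ c y
    ... | yes eq rewrite count-∷-≡ c {c x} {y} xs (sym eq) | eq = refl
    ... | no neq rewrite count-∷-≢ c {c x} {y} xs (≢-sym neq) =
      solve 3 (λ a b p → a :+ (b :+ p) := b :+ (a :+ p)) refl
        (count c (c x) xs) (count c (c y) xs) (#monoPairs xs)
      where open +-*-Solver

  -- A pair is coloured by its first entry. Prepending an element of colour `i` adds one pair for
  -- each entry of colour `i`, which is the recursion of `triangle`; any other element adds no pair
  -- of colour `i`.
  count-monoPairs : ∀ i xs → count (c ∘ proj₁) i (monoPairs xs) ≡ triangle (count c i xs)
  count-monoPairs i []       = refl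
  count-monoPairs i (x ∷ xs) = begin
    List.length (filter P? (new ++ monoPairs xs))
      ≡⟨ cong List.length (List.filter-++ P? new (monoPairs xs)) ⟩
    List.length (filter P? new ++ filter P? (monoPairs xs))
      ≡⟨ List.length-++ (filter P? new) ⟩
    List.length (filter P? new) + count (c ∘ proj₁) i (monoPairs xs)
      ≡⟨ cong (List.length (filter P? new) +_) (count-monoPairs i xs) ⟩
    List.length (filter P? new) + triangle (count c i xs)
      ≡⟨ counting-new ⟩
    triangle (count c i (x ∷ xs)) ∎
    where
    open ≡-Reasoning
    P? : Decidable (λ (p : A × A) → c (proj₁ p) ≡ i)
    P? p = c (proj₁ p) ≟ i
    new : List (A × A)
    new = map (x ,_) (filter (λ y → c y ≟ c x) xs)
    counting-new : List.length (filter P? new) + triangle (count c i xs) ≡ triangle (count c i (x ∷ xs))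
    counting-new with c x ≟ i
    ... | yes refl = cong (_+ triangle (count c (c x) xs))
            (trans (cong List.length (List.filter-all P? (All.map⁺ (All.universal (λ _ → refl) (filter _ xs)))))
                   (List.length-map _ (filter _ xs)))
    ... | no neq = cong (λ zs → List.length zs + triangle (count c i xs))
            (List.filter-none P? (All.map⁺ (All.universal (λ _ → neq) (filter _ xs))))

  module _ {R : A → A → Set} where

    ∈-monoPairs⁻ : ∀ {x y xs} → AllPairs R xs → (x , y) ∈ monoPairs xs →
                   x ∈ xs × y ∈ xs × R x y × c x ≡ c y
    ∈-monoPairs⁻ {xs = z ∷ zs} (Rz ∷ Rzs) xy∈
      with ∈-++⁻ (map (z ,_) (filter (λ y → c y ≟ c z) zs)) xy∈
    ... | inj₁ xy∈new with _ , y∈ , refl ← ∈-map⁻ (z ,_) xy∈new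
                      with y∈zs , cy≡cz ← ∈-filter⁻ (λ y → c y ≟ c z) {xs = zs} y∈ =
      here refl , there y∈zs , All.lookup Rz y∈zs , sym cy≡cz
    ... | inj₂ xy∈old with x∈ , y∈ , Rxy , eq ← ∈-monoPairs⁻ Rzs xy∈old =
      there x∈ , there y∈ , Rxy , eq

    -- In a list sorted by an asymmetric relation, `R x y` forces `x` to stand before `y`, as
    -- `monoPairs` requires.
    ∈-monoPairs⁺ : ∀ {x y xs} → (∀ {x y} → R x y → ¬ R y x) → AllPairs R xs →
                   x ∈ xs → y ∈ xs → R x y → c x ≡ c y → (x , y) ∈ monoPairs xs
    ∈-monoPairs⁺ asym (Rz ∷ Rzs) (here refl) (here refl) Rxy eq = contradiction Rxy (asym Rxy)
    ∈-monoPairs⁺ asym (Rz ∷ Rzs) (here refl) (there y∈)  Rxy eq =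
      ∈-++⁺ˡ (∈-map⁺ (_ ,_) (∈-filter⁺ (λ y → c y ≟ _) y∈ (sym eq)))
    ∈-monoPairs⁺ asym (Rz ∷ Rzs) (there x∈) (here refl) Rxy eq =
      contradiction Rxy (asym (All.lookup Rz x∈))
    ∈-monoPairs⁺ asym (Rz ∷ Rzs) (there x∈) (there y∈)  Rxy eq =
      ∈-++⁺ʳ _ (∈-monoPairs⁺ asym Rzs x∈ y∈ Rxy eq)

  monoPairs-unique : ∀ {xs} → Unique xs → Unique (monoPairs xs)
  monoPairs-unique []           = []
  monoPairs-unique (z≢ ∷ zs!) =
    Unique.++⁺ (Unique.map⁺ (λ { refl → refl }) (Unique.filter⁺ _ zs!)) (monoPairs-unique zs!)
      (λ (∈new , ∈old) → case ∈-map⁻ (_ ,_) ∈new of λ where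
        (_ , _ , refl) → contradiction refl (All.lookup z≢ (proj₁ (∈-monoPairs⁻ zs! ∈old))))

-- Subsets

elements : ∀ {n} → Subset n → List (Fin n)
elements []            = []
elements (inside  ∷ p) = zero ∷ map suc (elements p)
elements (outside ∷ p) = map suc (elements p)

length-elements : ∀ {n} (p : Subset n) → List.length (elements p) ≡ ∣ p ∣
length-elements []            = refl
length-elements (inside  ∷ p) = cong suc (trans (List.length-map suc (elements p)) (length-elements p))
length-elements (outside ∷ p) = trans (List.length-map suc (elements p)) (length-elements p)

elements-sorted : ∀ {n} (p : Subset n) → AllPairs Fin._<_ (elements p)
elements-sorted []            = []
elements-sorted (inside  ∷ p) =
  All.map⁺ (All.universal (λ _ → z<s) (elements p)) ∷
  AllPairs.map⁺ (AllPairs.map s<s (elements-sorted p))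
elements-sorted (outside ∷ p) = AllPairs.map⁺ (AllPairs.map s<s (elements-sorted p))

elements-unique : ∀ {n} (p : Subset n) → Unique (elements p)
elements-unique p = AllPairs.map Fin.<⇒≢ (elements-sorted p)

∈-elements⁺ : ∀ {n} {p : Subset n} {x} → x Subset.∈ p → x ∈ elements p
∈-elements⁺                    here        = here refl
∈-elements⁺ {p = inside  ∷ p} (there x∈p) = there (∈-map⁺ suc (∈-elements⁺ x∈p))
∈-elements⁺ {p = outside ∷ p} (there x∈p) = ∈-map⁺ suc (∈-elements⁺ x∈p)

∈-elements⁻ : ∀ {n} (p : Subset n) {x} → x ∈ elements p → x Subset.∈ p
∈-elements⁻ (inside  ∷ p) (here refl)  = here
∈-elements⁻ (inside  ∷ p) (there x∈)   with _ , y∈ , refl ← ∈-map⁻ suc x∈ = there (∈-elements⁻ p y∈)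
∈-elements⁻ (outside ∷ p) x∈           with _ , y∈ , refl ← ∈-map⁻ suc x∈ = there (∈-elements⁻ p y∈)

-- Duplicate-free lists with the same members are equal as bags, hence permutations of each other.
-- In this form, changing a set by one element translates into changes of the counts.
elements-↭ : ∀ {n} {p q : Subset n} {y} → y Subset.∉ q →
             (∀ {z} → z Subset.∈ p → z ≡ y ⊎ z Subset.∈ q) →
             y Subset.∈ p → (∀ {z} → z Subset.∈ q → z Subset.∈ p) →
             elements p ↭ y ∷ elements q
elements-↭ {p = p} {q} {y} y∉q split y∈p q⊆p =
  ∼bag⇒↭ (unique∧set⇒bag (elements-unique p) (y≢ ∷ elements-unique q) (mk⇔ to from))
  where
  y≢ : All (y ≢_) (elements q)
  y≢ = All.tabulate λ { z∈ refl → y∉q (∈-elements⁻ q z∈) }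
  to : ∀ {z} → z ∈ elements p → z ∈ y ∷ elements q
  to z∈ with split (∈-elements⁻ p z∈)
  ... | inj₁ refl = here refl
  ... | inj₂ z∈q  = there (∈-elements⁺ z∈q)
  from : ∀ {z} → z ∈ y ∷ elements q → z ∈ elements p
  from (here refl) = ∈-elements⁺ y∈p
  from (there z∈)  = ∈-elements⁺ (q⊆p (∈-elements⁻ q z∈))

x∉p-x : ∀ {n} (p : Subset n) x → x Subset.∉ p - x
x∉p-x (inside  ∷ p) zero    ()
x∉p-x (outside ∷ p) zero    ()
x∉p-x (_       ∷ p) (suc x) (there x∈) = x∉p-x p x x∈

module _ {n} {p : Subset n} {x} (x∈p : x Subset.∈ p) where

  private
    p-x⊆p : ∀ {z} → z Subset.∈ p - x → z Subset.∈ p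
    p-x⊆p = p─q⊆p p ⁅ x ⁆
    cases : ∀ {z} → z Subset.∈ p → z ≡ x ⊎ z Subset.∈ p - x
    cases {z} z∈p with z ≟ x
    ... | yes z≡x = inj₁ z≡x
    ... | no  z≢x = inj₂ (x∈p∧x≢y⇒x∈p-y z∈p z≢x)

  elements-delete : elements p ↭ x ∷ elements (p - x)
  elements-delete = elements-↭ (x∉p-x p x) cases x∈p p-x⊆p

  elements-∁-delete : elements (∁ (p - x)) ↭ x ∷ elements (∁ p)
  elements-∁-delete = elements-↭ (x∈p⇒x∉∁p x∈p) cases′ (x∉p⇒x∈∁p (x∉p-x p x))
    (λ z∈∁p → x∉p⇒x∈∁p (x∈∁p⇒x∉p z∈∁p ∘ p-x⊆p))
    where
    cases′ : ∀ {z} → z Subset.∈ ∁ (p - x) → z ≡ x ⊎ z Subset.∈ ∁ p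
    cases′ {z} z∈ with z ∈? p
    ... | no z∉p = inj₂ (x∉p⇒x∈∁p z∉p)
    ... | yes z∈p with cases z∈p
    ...   | inj₁ z≡x = inj₁ z≡x
    ...   | inj₂ z∈p-x = contradiction z∈p-x (x∈∁p⇒x∉p z∈)

module _ {n} {p : Subset n} {y} (y∉p : y Subset.∉ p) where

  private
    cases : ∀ {z} → z Subset.∈ p ∪ ⁅ y ⁆ → z ≡ y ⊎ z Subset.∈ p
    cases z∈ with x∈p∪q⁻ p ⁅ y ⁆ z∈
    ... | inj₁ z∈p = inj₂ z∈p
    ... | inj₂ z∈y = inj₁ (x∈⁅y⁆⇒x≡y y z∈y)
    y∈ : y Subset.∈ p ∪ ⁅ y ⁆
    y∈ = x∈p∪q⁺ (inj₂ (x∈⁅x⁆ y))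

  elements-insert : elements (p ∪ ⁅ y ⁆) ↭ y ∷ elements p
  elements-insert = elements-↭ y∉p cases y∈ (x∈p∪q⁺ ∘ inj₁)

  elements-∁-insert : elements (∁ p) ↭ y ∷ elements (∁ (p ∪ ⁅ y ⁆))
  elements-∁-insert = elements-↭ (x∈p⇒x∉∁p y∈) cases′ (x∉p⇒x∈∁p y∉p)
    (λ z∈ → x∉p⇒x∈∁p (x∈∁p⇒x∉p z∈ ∘ x∈p∪q⁺ ∘ inj₁))
    where
    cases′ : ∀ {z} → z Subset.∈ ∁ p → z ≡ y ⊎ z Subset.∈ ∁ (p ∪ ⁅ y ⁆)
    cases′ {z} z∈∁p with z ∈? (p ∪ ⁅ y ⁆)
    ... | no z∉ = inj₂ (x∉p⇒x∈∁p z∉)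
    ... | yes z∈ with cases z∈
    ...   | inj₁ z≡y = inj₁ z≡y
    ...   | inj₂ z∈p = contradiction z∈p (x∈∁p⇒x∉p z∈∁p)

subset-bounded : ∀ {n} (μ : Subset n → ℕ) → ∃[ b ] (∀ p → μ p ≤ b)
subset-bounded {zero}  μ = μ [] , λ { [] → ℕ.≤-refl }
subset-bounded {suc n} μ
  with b , ≤b ← subset-bounded (μ ∘ (inside ∷_)) | b′ , ≤b′ ← subset-bounded (μ ∘ (outside ∷_)) =
  b + b′ , λ where
    (inside  ∷ p) → ℕ.≤-trans (≤b p) (ℕ.m≤m+n b b′)
    (outside ∷ p) → ℕ.≤-trans (≤b′ p) (ℕ.m≤n+m b′ b)

subset-minimal : ∀ {n} {P : Subset n → Set} → Decidable P → (μ : Subset n → ℕ) → ∃ P →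
                 ∃[ p ] P p × (∀ q → P q → μ p ≤ μ q)
subset-minimal {P = P} P? μ (p , Pp) = go p Pp (<-wellFounded (μ p))
  where
  go : ∀ p → P p → Acc _<_ (μ p) → ∃[ p ] P p × (∀ q → P q → μ p ≤ μ q)
  go p Pp (acc rs) with anySubset? (λ q → P? q ×-dec μ q <? μ p)
  ... | yes (q , Pq , q<p) = go q Pq (rs q<p)
  ... | no  none           = p , Pp , λ q Pq → ℕ.≮⇒≥ (λ q<p → none (q , Pq , q<p))

subset-maximal : ∀ {n} {P : Subset n → Set} → Decidable P → (μ : Subset n → ℕ) → ∃ P →
                 ∃[ p ] P p × (∀ q → P q → μ q ≤ μ p)
subset-maximal P? μ inhabited
  with b , ≤b ← subset-bounded μ
  -- Maximising `μ` becomes minimising `b ∸ μ`; the truncation is harmless since `b` bounds all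
  -- values of `μ`.
  with p , Pp , min ← subset-minimal P? (λ p → b ∸ μ p) inhabited =
  p , Pp , λ q Pq → ℕ.∸-cancelʳ-≤ (≤b q) (min q Pq)

comprehension : ∀ {n} {P : Fin n → Set} → Decidable P → Subset n
comprehension P? = tabulate (does ∘ P?)

∈-comprehension⁺ : ∀ {n} {P : Fin n → Set} (P? : Decidable P) {i} →
                   P i → i Subset.∈ comprehension P?
∈-comprehension⁺ P? {i} Pi =
  lookup⇒[]= i _ (trans (lookup∘tabulate (does ∘ P?) i) (dec-true (P? i) Pi))

∈-comprehension⁻ : ∀ {n} {P : Fin n → Set} (P? : Decidable P) {i} →
                   i Subset.∈ comprehension P? → P i
∈-comprehension⁻ P? {i} i∈ = decidable-stable (P? i) λ ¬Pi →
  case trans (sym (trans (sym (lookup∘tabulate (does ∘ P?) i)) ([]=⇒lookup i∈))) (dec-false (P? i) ¬Pi) of λ ()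

-- Applied to the set of split parts: either it is small enough to be the exceptional set, or three
-- of them are available for an exchange.
∣p∣≤2⊎three : ∀ {n} (p : Subset n) → ∣ p ∣ ≤ 2 ⊎
  ∃[ i ] ∃[ j ] ∃[ k ] (i Subset.∈ p × j Subset.∈ p × k Subset.∈ p × i ≢ j × i ≢ k × j ≢ k)
∣p∣≤2⊎three p with elements p | length-elements p | elements-unique p | ∈-elements⁻ p
... | []              | eq | _ | _ = inj₁ (subst (_≤ 2) eq z≤n)
... | _ ∷ []          | eq | _ | _ = inj₁ (subst (_≤ 2) eq (s≤s z≤n))
... | _ ∷ _ ∷ []      | eq | _ | _ = inj₁ (subst (_≤ 2) eq (s≤s (s≤s z≤n)))
... | i ∷ j ∷ k ∷ _   | _  | (i≢j ∷ i≢k ∷ _) ∷ (j≢k ∷ _) ∷ _ | ∈p =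
  inj₂ (i , j , k , ∈p (here refl) , ∈p (there (here refl)) , ∈p (there (there (here refl))) ,
        i≢j , i≢k , j≢k)

∃-other-element : ∀ {n} (p : Subset n) → 2 ≤ ∣ p ∣ → ∀ v → ∃[ w ] w Subset.∈ p × v ≢ w
∃-other-element p 2≤∣p∣ v
  with elements p | length-elements p | elements-unique p | ∈-elements⁻ p
... | []        | eq | _ | _ = contradiction (subst (2 ≤_) (sym eq) 2≤∣p∣) λ ()
... | _ ∷ []    | eq | _ | _ = contradiction (subst (2 ≤_) (sym eq) 2≤∣p∣) λ { (s≤s ()) }
... | a ∷ b ∷ _ | _  | (a≢b ∷ _) ∷ _ | ∈p with v ≟ a
...   | no v≢a   = a , ∈p (here refl) , v≢a
...   | yes refl = b , ∈p (there (here refl)) , a≢b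

-- Hall's condition for the strong geodetic sets

module _ {r : ℕ} {A : Set} (c : A → Fin r) where

  -- A monochromatic pair of the set with elements ins can cover one of the
  -- remaining vertices outs, of a different colour.
  Balanced : List A → List A → Set
  Balanced ins outs = List.length outs ≤ #monoPairs c ins ×
    (∀ i → count c i outs + triangle (count c i ins) ≤ #monoPairs c ins)

  balanced-↭ : ∀ {ins ins′} outs → ins ↭ ins′ → Balanced ins outs → Balanced ins′ outs
  balanced-↭ outs p (total , parts) =
    subst (_ ≤_) (#monoPairs-↭ c p) total ,
    λ i → subst₂ _≤_ (cong (λ k → count c i outs + triangle k) (count-↭ c i p))
                     (#monoPairs-↭ c p) (parts i)

  -- `x` leaves the set, `y` enters, and `ins` stays. The number of pairs changes from
  -- `count c (c x) ins + #monoPairs c ins` to `count c (c y) ins + #monoPairs c ins`, so it grows.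
  -- For colours other than those of `x` and `y` the left sides of the conditions do not change.
  balanced-exchange : ∀ {x y ins outs outs′} → x ∷ outs ↭ y ∷ outs′ → c x ≢ c y →
    count c (c x) ins < count c (c y) ins →
    count c (c y) outs + triangle (count c (c y) ins) ≤ suc (#monoPairs c ins) →
    Balanced (x ∷ ins) outs →
    Balanced (y ∷ ins) outs′ × #monoPairs c (x ∷ ins) < #monoPairs c (y ∷ ins)
  balanced-exchange {x} {y} {ins} {outs} {outs′} outs↭ cx≢cy u<s room (total , parts) =
    (total′ , parts′) , P<P′
    where
    open ℕ.≤-Reasoning
    P<P′ : #monoPairs c (x ∷ ins) < #monoPairs c (y ∷ ins)
    P<P′ = begin-strict
      #monoPairs c (x ∷ ins)                     ≡⟨ #monoPairs-∷ c x ins ⟩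
      count c (c x) ins + #monoPairs c ins       <⟨ ℕ.+-monoˡ-< _ u<s ⟩
      count c (c y) ins + #monoPairs c ins       ≡⟨ #monoPairs-∷ c y ins ⟨
      #monoPairs c (y ∷ ins)                     ∎
    total′ : List.length outs′ ≤ #monoPairs c (y ∷ ins)
    total′ = begin
      List.length outs′         ≡⟨ ℕ.suc-injective (↭-length outs↭) ⟨
      List.length outs          ≤⟨ total ⟩
      #monoPairs c (x ∷ ins)    ≤⟨ ℕ.<⇒≤ P<P′ ⟩
      #monoPairs c (y ∷ ins)    ∎
    -- Adding `y` to `ins` raises the triangle of its colour and the number of pairs by the same
    -- amount `s`. That `y` is no longer outside makes up for the `suc` in `room`.
    part-y : count c (c y) outs′ + triangle (count c (c y) (y ∷ ins)) ≤ #monoPairs c (y ∷ ins)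
    part-y = ℕ.s≤s⁻¹ (begin
      suc (count c (c y) outs′ + triangle (count c (c y) (y ∷ ins)))
        ≡⟨ cong (λ k → suc (count c (c y) outs′ + triangle k)) (count-∷-≡ c ins refl) ⟩
      suc (count c (c y) outs′) + (s + triangle s)
        ≡⟨ cong (_+ (s + triangle s)) outs-y ⟨
      count c (c y) outs + (s + triangle s)
        ≡⟨ solve 3 (λ d s t → d :+ (s :+ t) := s :+ (d :+ t)) refl (count c (c y) outs) s (triangle s) ⟩
      s + (count c (c y) outs + triangle s)
        ≤⟨ ℕ.+-monoʳ-≤ s room ⟩
      s + suc (#monoPairs c ins)
        ≡⟨ ℕ.+-suc s _ ⟩
      suc (s + #monoPairs c ins)
        ≡⟨ cong suc (#monoPairs-∷ c y ins) ⟨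
      suc (#monoPairs c (y ∷ ins)) ∎)
      where
      open +-*-Solver
      s : ℕ
      s = count c (c y) ins
      outs-y : count c (c y) outs ≡ suc (count c (c y) outs′)
      outs-y = trans (sym (count-∷-≢ c outs cx≢cy))
                     (trans (count-↭ c (c y) outs↭) (count-∷-≡ c outs′ refl))
    -- Cancelling `u` in the old condition bounds the left side before `x` moves outside by
    -- `#monoPairs c ins`. The move costs one, and the `count c (c y) ins` new pairs pay for it:
    -- there is at least one because of `u<s`.
    part-x : count c (c x) outs′ + triangle (count c (c x) (y ∷ ins)) ≤ #monoPairs c (y ∷ ins)
    part-x = begin
      count c (c x) outs′ + triangle (count c (c x) (y ∷ ins))
        ≡⟨ cong₂ _+_ outs′-x (cong triangle (count-∷-≢ c ins (≢-sym cx≢cy))) ⟩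
      suc (count c (c x) outs + triangle u)
        ≤⟨ s≤s (ℕ.+-cancelˡ-≤ u _ _ (begin
          u + (count c (c x) outs + triangle u)
            ≡⟨ solve 3 (λ u d t → u :+ (d :+ t) := d :+ (u :+ t)) refl u (count c (c x) outs) (triangle u) ⟩
          count c (c x) outs + triangle (suc u)
            ≡⟨ cong (λ k → count c (c x) outs + triangle k) (count-∷-≡ c ins refl) ⟨
          count c (c x) outs + triangle (count c (c x) (x ∷ ins))
            ≤⟨ parts (c x) ⟩
          #monoPairs c (x ∷ ins)
            ≡⟨ #monoPairs-∷ c x ins ⟩
          u + #monoPairs c ins ∎)) ⟩
      1 + #monoPairs c ins
        ≤⟨ ℕ.+-monoˡ-≤ _ (ℕ.≤-trans (s≤s z≤n) u<s) ⟩
      count c (c y) ins + #monoPairs c ins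
        ≡⟨ #monoPairs-∷ c y ins ⟨
      #monoPairs c (y ∷ ins) ∎
      where
      open +-*-Solver
      u : ℕ
      u = count c (c x) ins
      outs′-x : count c (c x) outs′ ≡ suc (count c (c x) outs)
      outs′-x = trans (sym (count-∷-≢ c outs′ (≢-sym cx≢cy)))
                      (trans (sym (count-↭ c (c x) outs↭)) (count-∷-≡ c outs refl))
    parts′ : ∀ i → count c i outs′ + triangle (count c i (y ∷ ins)) ≤ #monoPairs c (y ∷ ins)
    parts′ i = go (c y ≟ i) (c x ≟ i)
      where
      go : Dec (c y ≡ i) → Dec (c x ≡ i) →
           count c i outs′ + triangle (count c i (y ∷ ins)) ≤ #monoPairs c (y ∷ ins)
      go (yes refl) _          = part-y
      go (no _)     (yes refl) = part-x
      go (no cy≢i)  (no cx≢i)  = begin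
        count c i outs′ + triangle (count c i (y ∷ ins))
          ≡⟨ cong (λ k → count c i outs′ + triangle k) (count-∷-≢ c ins cy≢i) ⟩
        count c i outs′ + triangle (count c i ins)
          ≡⟨ cong₂ _+_ outs-i (cong triangle (count-∷-≢ c ins cx≢i)) ⟨
        count c i outs + triangle (count c i (x ∷ ins))
          ≤⟨ parts i ⟩
        #monoPairs c (x ∷ ins)
          ≤⟨ ℕ.<⇒≤ P<P′ ⟩
        #monoPairs c (y ∷ ins) ∎
        where
        outs-i : count c i outs ≡ count c i outs′
        outs-i = trans (sym (count-∷-≢ c outs cx≢i))
                       (trans (count-↭ c i outs↭) (count-∷-≢ c outs′ cy≢i))

  -- If both colours were tight, adding the two violated inequalities to the
  -- total one would give 4 + triangle u ≤ u, where u is the number of elements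
  -- of ins with the colour of x.
  balanced-room : ∀ {x i j} ins outs → i ≢ j → i ≢ c x → j ≢ c x → Balanced (x ∷ ins) outs →
    count c i outs + triangle (count c i ins) ≤ suc (#monoPairs c ins) ⊎
    count c j outs + triangle (count c j ins) ≤ suc (#monoPairs c ins)
  balanced-room {x} {i} {j} ins outs i≢j i≢m j≢m (total , _)
    with count c i outs + triangle (count c i ins) ≤? suc (#monoPairs c ins)
       | count c j outs + triangle (count c j ins) ≤? suc (#monoPairs c ins)
  ... | yes room | _        = inj₁ room
  ... | no _     | yes room = inj₂ room
  ... | no ¬i    | no ¬j    = contradiction (ℕ.+-cancelˡ-≤ (p + p) _ _ chain) (ℕ.<⇒≱ (begin-strict
      u              ≤⟨ n≤1+triangle u ⟩
      suc (triangle u) <⟨ ℕ.m≤n⇒m≤1+n (ℕ.m≤n⇒m≤1+n ℕ.≤-refl) ⟩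
      4 + triangle u ∎))
    where
    open ℕ.≤-Reasoning
    p u di dj dm ti tj : ℕ
    p  = #monoPairs c ins
    u  = count c (c x) ins
    di = count c i outs
    dj = count c j outs
    dm = count c (c x) outs
    ti = triangle (count c i ins)
    tj = triangle (count c j ins)
    pairs : ti + tj + triangle u ≤ p
    pairs = begin
      ti + tj + triangle u
        ≡⟨ cong₂ _+_ (cong₂ _+_ (count-monoPairs c i ins) (count-monoPairs c j ins))
                     (count-monoPairs c (c x) ins) ⟨
      count (c ∘ proj₁) i (monoPairs c ins) + count (c ∘ proj₁) j (monoPairs c ins)
        + count (c ∘ proj₁) (c x) (monoPairs c ins)
        ≤⟨ count-three (c ∘ proj₁) i≢j i≢m j≢m (monoPairs c ins) ⟩
      p ∎
    chain : p + p + (4 + triangle u) ≤ p + p + u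
    chain = begin
      p + p + (4 + triangle u)
        -- The 4 is twice 2: a condition that exceeds `suc p` has a left side of at least `2 + p`,
        -- and this happens for both `i` and `j`.
        ≡⟨ solve 2 (λ p t → p :+ p :+ (con 4 :+ t) := (con 2 :+ p) :+ (con 2 :+ p) :+ t) refl p (triangle u) ⟩
      (2 + p) + (2 + p) + triangle u
        ≤⟨ ℕ.+-monoˡ-≤ (triangle u) (ℕ.+-mono-≤ (ℕ.≰⇒> ¬i) (ℕ.≰⇒> ¬j)) ⟩
      (di + ti) + (dj + tj) + triangle u
        -- The outside vertices with the colour of `x` are added so that `count-three` bounds
        -- `di + dj + dm` by the number of all outside vertices.
        ≤⟨ ℕ.m≤m+n _ dm ⟩
      (di + ti) + (dj + tj) + triangle u + dm
        ≡⟨ solve 6 (λ di ti dj tj t dm → (di :+ ti) :+ (dj :+ tj) :+ t :+ dm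
                                       := (di :+ dj :+ dm) :+ (ti :+ tj :+ t))
                 refl di ti dj tj (triangle u) dm ⟩
      (di + dj + dm) + (ti + tj + triangle u)
        ≤⟨ ℕ.+-mono-≤ (ℕ.≤-trans (count-three c i≢j i≢m j≢m outs) total) pairs ⟩
      #monoPairs c (x ∷ ins) + p
        ≡⟨ cong (_+ p) (#monoPairs-∷ c x ins) ⟩
      u + p + p
        ≡⟨ solve 2 (λ u p → u :+ p :+ p := p :+ p :+ u) refl u p ⟩
      p + p + u ∎
      where open +-*-Solver

-- Feasible sets and the extremal choice among them.

module _ {n r : ℕ} (c : Fin n → Fin r) where

  #pairs : Subset n → ℕ
  #pairs S = #monoPairs c (elements S)

  -- `2 ≤ ∣ S ∣` gives each vertex of `S` a second one, so that it is the end of a selected path;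
  -- `Balanced` takes care of the vertices outside.
  Feasible : Subset n → Set
  Feasible S = 2 ≤ ∣ S ∣ × Balanced c (elements S) (elements (∁ S))

  feasible? : Decidable Feasible
  feasible? S = 2 ≤? ∣ S ∣ ×-dec (_ ≤? _ ×-dec Fin.all? (λ i → _ ≤? _))

  -- With nothing outside, it remains that the pairs of one colour are among all pairs. `balanced`
  -- is stated for any list `outs` without members because `elements (∁ ⊤)` does not reduce to `[]`.
  feasible-⊤ : 2 ≤ n → Feasible ⊤
  feasible-⊤ 2≤n = subst (2 ≤_) (sym (∣⊤∣≡n n)) 2≤n , balanced (elements (∁ ⊤)) no-element
    where
    no-element : ∀ {z} → z ∉ elements (∁ ⊤)
    no-element z∈ = x∈∁p⇒x∉p (∈-elements⁻ (∁ ⊤) z∈) ∈⊤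
    balanced : ∀ outs → (∀ {z} → z ∉ outs) → Balanced c (elements ⊤) outs
    balanced []      _     = z≤n , λ i →
      subst (_≤ _) (count-monoPairs c i (elements ⊤))
            (List.length-filter (λ p → c (proj₁ p) ≟ i) (monoPairs c (elements ⊤)))
    balanced (_ ∷ _) empty = contradiction (here refl) empty

  exchange : ∀ {S x y} → Feasible S → x Subset.∈ S → y Subset.∉ S → c x ≢ c y →
    count c (c x) (elements S) ≤ count c (c y) (elements S) →
    count c (c y) (elements (∁ S)) + triangle (count c (c y) (elements (S - x))) ≤ suc (#pairs (S - x)) →
    ∃[ S′ ] Feasible S′ × ∣ S′ ∣ ≡ ∣ S ∣ × #pairs S < #pairs S′
  exchange {S} {x} {y} (2≤∣S∣ , balanced) x∈S y∉S cx≢cy s≤s′ room =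
    S′ , (subst (2 ≤_) (sym size) 2≤∣S∣ , balanced-↭ c (elements (∁ S′)) (↭-sym ins′) (proj₁ exchanged)) , size ,
    subst₂ _<_ (sym (#monoPairs-↭ c ins)) (sym (#monoPairs-↭ c ins′)) (proj₂ exchanged)
    where
    S′ : Subset n
    S′ = (S - x) ∪ ⁅ y ⁆
    y∉S-x : y Subset.∉ S - x
    y∉S-x = y∉S ∘ p─q⊆p S ⁅ x ⁆
    ins : elements S ↭ x ∷ elements (S - x)
    ins = elements-delete x∈S
    ins′ : elements S′ ↭ y ∷ elements (S - x)
    ins′ = elements-insert y∉S-x
    size : ∣ S′ ∣ ≡ ∣ S ∣
    size = begin
      ∣ S′ ∣                    ≡⟨ length-elements S′ ⟨
      List.length (elements S′) ≡⟨ trans (↭-length ins′) (sym (↭-length ins)) ⟩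
      List.length (elements S)  ≡⟨ length-elements S ⟩
      ∣ S ∣                     ∎
      where open ≡-Reasoning
    -- The weak inequality for `S` becomes strict for `S - x`, as only the colour of `x` loses an
    -- element.
    u<s : count c (c x) (elements (S - x)) < count c (c y) (elements (S - x))
    u<s = subst₂ _≤_ (trans (count-↭ c (c x) ins) (count-∷-≡ c _ refl))
                     (trans (count-↭ c (c y) ins) (count-∷-≢ c _ cx≢cy)) s≤s′
    exchanged : Balanced c (y ∷ elements (S - x)) (elements (∁ S′)) ×
                #monoPairs c (x ∷ elements (S - x)) < #monoPairs c (y ∷ elements (S - x))
    exchanged = balanced-exchange c
      (↭-trans (↭-sym (elements-∁-delete x∈S)) (elements-∁-insert y∉S-x))
      cx≢cy u<s room (balanced-↭ c (elements (∁ S)) ins balanced)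

  Split : Subset n → Fin r → Set
  Split S i = (∃[ v ] v Subset.∈ S × c v ≡ i) × (∃[ v ] v Subset.∉ S × c v ≡ i)

  split? : ∀ S → Decidable (Split S)
  split? S i = Fin.any? (λ v → v ∈? S ×-dec c v ≟ i) ×-dec
               Fin.any? (λ v → ¬? (v ∈? S) ×-dec c v ≟ i)

  Improvement : Subset n → Set
  Improvement S = ∃[ S′ ] Feasible S′ × ∣ S′ ∣ ≡ ∣ S ∣ × #pairs S < #pairs S′

  -- `k` is the donor because it meets `S` least. `balanced-room` shows that `i` or `j` can receive,
  -- and either has a vertex outside `S` to add.
  improve-from : ∀ {S i j k} → Feasible S → Split S i → Split S j → Split S k →
    i ≢ j → i ≢ k → j ≢ k →
    count c k (elements S) ≤ count c i (elements S) →
    count c k (elements S) ≤ count c j (elements S) → Improvement S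
  improve-from {S} feas@(_ , balanced) (_ , y , y∉S , refl) (_ , z , z∉S , refl) ((x , x∈S , refl) , _)
               i≢j i≢k j≢k k≤i k≤j
    with balanced-room c (elements (S - x)) (elements (∁ S)) i≢j i≢k j≢k
           (balanced-↭ c (elements (∁ S)) (elements-delete x∈S) balanced)
  ... | inj₁ room = exchange feas x∈S y∉S (≢-sym i≢k) k≤i room
  ... | inj₂ room = exchange feas x∈S z∉S (≢-sym j≢k) k≤j room

  improve : ∀ {S i j k} → Feasible S → Split S i → Split S j → Split S k →
            i ≢ j → i ≢ k → j ≢ k → Improvement S
  improve {S} {i} {j} {k} feas si sj sk i≢j i≢k j≢k
    with ℕ.≤-total (s i) (s j) | ℕ.≤-total (s j) (s k) | ℕ.≤-total (s i) (s k)
    where s = λ l → count c l (elements S)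
  ... | inj₁ i≤j | _        | inj₁ i≤k = improve-from feas sj sk si j≢k (≢-sym i≢j) (≢-sym i≢k) i≤j i≤k
  ... | inj₁ i≤j | _        | inj₂ k≤i =
    improve-from feas si sj sk i≢j i≢k j≢k k≤i (ℕ.≤-trans k≤i i≤j)
  ... | inj₂ j≤i | inj₁ j≤k | _        = improve-from feas si sk sj i≢k i≢j (≢-sym j≢k) j≤i j≤k
  ... | inj₂ j≤i | inj₂ k≤j | _        =
    improve-from feas si sj sk i≢j i≢k j≢k (ℕ.≤-trans k≤j j≤i) k≤j

  feasible-optimum : ∃ Feasible → ∃[ S ] Feasible S × (∀ T → Feasible T → ∣ S ∣ ≤ ∣ T ∣) ×
                     ∣ comprehension (split? S) ∣ ≤ 2
  feasible-optimum inhabited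
    with S₀ , feas₀ , min ← subset-minimal feasible? ∣_∣ inhabited
    with S , (feas , size) , max ←
      subset-maximal (λ S → feasible? S ×-dec ∣ S ∣ ℕ.≟ ∣ S₀ ∣) #pairs (S₀ , feas₀ , refl)
    with ∣p∣≤2⊎three (comprehension (split? S))
  ... | inj₁ ≤2 = S , feas , (λ T feasT → subst (_≤ ∣ T ∣) (sym size) (min T feasT)) , ≤2
  ... | inj₂ (i , j , k , i∈ , j∈ , k∈ , i≢j , i≢k , j≢k)
    with S′ , feas′ , size′ , S<S′ ← improve feas (∈-comprehension⁻ (split? S) i∈)
      (∈-comprehension⁻ (split? S) j∈) (∈-comprehension⁻ (split? S) k∈) i≢j i≢k j≢k =
    contradiction (max S′ (feas′ , trans size′ size)) (ℕ.<⇒≱ S<S′)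

-- Strong geodetic sets of a complete multipartite graph

-- A pair serves only one vertex, so the middle vertex of its path is determined by the matching.
partner-unique : ∀ {A B : Set} {ms : List (A × B)} {free a a′ b} →
  Unique (map proj₂ ms ++ free) → (a , b) ∈ ms → (a′ , b) ∈ ms → a ≡ a′
partner-unique _          (here refl) (here refl)  = refl
partner-unique (b≢ ∷ _)   (here refl) (there m′∈)  =
  contradiction refl (All.lookup b≢ (∈-++⁺ˡ (∈-map⁺ proj₂ m′∈)))
partner-unique (b≢ ∷ _)   (there m∈)  (here refl)  =
  contradiction refl (All.lookup b≢ (∈-++⁺ˡ (∈-map⁺ proj₂ m∈)))
partner-unique {ms = _ ∷ _} (_ ∷ bs!) (there m∈) (there m′∈) = partner-unique bs! m∈ m′∈

∉∈⇒≢ : ∀ {n} {p : Subset n} {x y} → x Subset.∉ p → y Subset.∈ p → x ≢ y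
∉∈⇒≢ x∉p y∈p refl = x∉p y∈p

-- Shortest paths: single edges and detours of length two.

module _ {n : ℕ} (G : Graph n) where

  first∈vertices : ∀ {x y} (w : Walk G x y) → x ∈ vertices G w
  first∈vertices ε       = here refl
  first∈vertices (_ ◅ _) = here refl

  last∈vertices : ∀ {x y} (w : Walk G x y) → y ∈ vertices G w
  last∈vertices ε       = here refl
  last∈vertices (_ ◅ w) = there (last∈vertices w)

module _ {n r : ℕ} (G : Graph n) (c : Fin n → Fin r)
         (adj⇔ : ∀ {u v} → Adj G u v ⇔ c u ≢ c v) where

  private
    adj⁻ : ∀ {u v} → Adj G u v → c u ≢ c v
    adj⁻ = Equivalence.to adj⇔
    adj⁺ : ∀ {u v} → c u ≢ c v → Adj G u v
    adj⁺ = Equivalence.from adj⇔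

  edgePath : ∀ {x y} → c x ≢ c y → ShortestPath G x y
  edgePath cx≢cy = adj⁺ cx≢cy ◅ ε , ((cx≢cy ∘ cong c) ∷ []) ∷ [] ∷ [] , λ where
    ε       _ → contradiction refl cx≢cy
    (_ ◅ _) _ → s≤s z≤n

  -- Ends of equal colour are not adjacent, so two edges are the minimum, and any `z` of another
  -- colour can be the middle. This freedom is what the matching exploits.
  detour : ∀ {x y} → x ≢ y → c x ≡ c y → ∀ {z} → c x ≢ c z → ShortestPath G x y
  detour x≢y cx≡cy cx≢cz =
    adj⁺ cx≢cz ◅ adj⁺ cz≢cy ◅ ε ,
    ((cx≢cz ∘ cong c) ∷ x≢y ∷ []) ∷ ((cz≢cy ∘ cong c) ∷ []) ∷ [] ∷ [] , λ where
      ε           _ → contradiction refl x≢y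
      (e ◅ ε)     _ → contradiction cx≡cy (adj⁻ e)
      (_ ◅ _ ◅ _) _ → s≤s (s≤s z≤n)
    where cz≢cy = λ cz≡cy → cx≢cz (trans cx≡cy (sym cz≡cy))

  endpoint-of-edge : ∀ {x y v} (w : Walk G x y) → length G w ≤ 1 → v ∈ vertices G w → v ≡ x ⊎ v ≡ y
  endpoint-of-edge ε       _ (here refl)         = inj₁ refl
  endpoint-of-edge (_ ◅ ε) _ (here refl)         = inj₁ refl
  endpoint-of-edge (_ ◅ ε) _ (there (here refl)) = inj₂ refl
  endpoint-of-edge (_ ◅ _ ◅ _) (s≤s ()) _

  -- With at most two edges, an inner vertex is reached by the first edge, and adjacent vertices
  -- differ in colour.
  inner-adjacent : ∀ {x y v} (w : Walk G x y) → length G w ≤ 2 →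
                   v ∈ vertices G w → v ≢ x → v ≢ y → c x ≢ c v
  inner-adjacent ε           _ (here refl)                 v≢x _   = contradiction refl v≢x
  inner-adjacent (_ ◅ _)     _ (here refl)                 v≢x _   = contradiction refl v≢x
  inner-adjacent (_ ◅ ε)     _ (there (here refl))         _   v≢y = contradiction refl v≢y
  inner-adjacent (e ◅ _ ◅ ε) _ (there (here refl))         _   _   = adj⁻ e
  inner-adjacent (_ ◅ _ ◅ ε) _ (there (there (here refl))) _   v≢y = contradiction refl v≢y
  inner-adjacent (_ ◅ _ ◅ _ ◅ _) (s≤s (s≤s ())) _ _ _

  inner-unique : ∀ {x y u v} (w : Walk G x y) → length G w ≤ 2 →
    u ∈ vertices G w → u ≢ x → u ≢ y → v ∈ vertices G w → v ≢ x → v ≢ y → u ≡ v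
  inner-unique w ≤2 u∈ u≢x u≢y v∈ v≢x v≢y =
    trans (is-middle w ≤2 u∈ u≢x u≢y) (sym (is-middle w ≤2 v∈ v≢x v≢y))
    where
    middle : ∀ {x y} → Walk G x y → Fin n
    -- A default value: `ε` has no vertex besides its ends.
    middle {x} ε             = x
    middle (_◅_ {j = z} _ _) = z
    is-middle : ∀ {x y v} (w : Walk G x y) → length G w ≤ 2 →
                v ∈ vertices G w → v ≢ x → v ≢ y → v ≡ middle w
    is-middle ε           _ (here refl)                 v≢x _   = contradiction refl v≢x
    is-middle (_ ◅ _)     _ (here refl)                 v≢x _   = contradiction refl v≢x
    is-middle (_ ◅ ε)     _ (there (here refl))         _   _   = refl
    is-middle (_ ◅ _ ◅ ε) _ (there (here refl))         _   _   = refl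
    is-middle (_ ◅ _ ◅ ε) _ (there (there (here refl))) _   v≢y = contradiction refl v≢y
    is-middle (_ ◅ _ ◅ _ ◅ _) (s≤s (s≤s ())) _ _ _

  shortest-≤1 : ∀ {x y} (p : ShortestPath G x y) → c x ≢ c y → length G (proj₁ p) ≤ 1
  shortest-≤1 (_ , _ , shortest) cx≢cy = shortest (proj₁ q) (proj₁ (proj₂ q))
    where q = edgePath cx≢cy

  module _ (other-colour : ∀ x → ∃[ z ] c x ≢ c z) where

    shortest-≤2 : ∀ {x y} (p : ShortestPath G x y) → x ≢ y → c x ≡ c y → length G (proj₁ p) ≤ 2
    shortest-≤2 {x} (_ , _ , shortest) x≢y cx≡cy =
      shortest (proj₁ q) (proj₁ (proj₂ q))
      where q = detour x≢y cx≡cy (proj₂ (other-colour x))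

    module _ {S : Subset n} (g : Selection G S) (covers : Covers G S g) where

      -- The order and membership proofs are bundled inside, which leaves a relation between
      -- vertices and bare pairs, as `injection⇒length-≤` expects.
      CoversVertex : Fin n → Fin n × Fin n → Set
      CoversVertex v (x , y) = v Subset.∉ S × c x ≡ c y ×
        Σ (x Fin.< y) λ x<y → Σ (x Subset.∈ S) λ x∈S → Σ (y Subset.∈ S) λ y∈S →
          v ∈ vertices G (proj₁ (g x<y x∈S y∈S))

      -- The bundled proofs are irrelevant, so both vertices lie on the same selected path, which
      -- has room for one inner vertex only.
      coversVertex-functional : ∀ {u v b} → CoversVertex u b → CoversVertex v b → u ≡ v
      coversVertex-functional (u∉S , eq , x<y , x∈S , y∈S , u∈) (v∉S , _ , x<y′ , x∈S′ , y∈S′ , v∈)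
        rewrite Fin.<-irrelevant x<y′ x<y | []=-irrelevant x∈S′ x∈S | []=-irrelevant y∈S′ y∈S =
        inner-unique _ (shortest-≤2 (g x<y x∈S y∈S) (Fin.<⇒≢ x<y) eq)
          u∈ (∉∈⇒≢ u∉S x∈S) (∉∈⇒≢ u∉S y∈S) v∈ (∉∈⇒≢ v∉S x∈S) (∉∈⇒≢ v∉S y∈S)

      -- Ends of selected paths lie in `S`, so `v` is an inner vertex. This excludes pairs of
      -- different colours, whose shortest paths are edges.
      covering-pair : ∀ {v} → v Subset.∉ S →
        ∃[ b ] b ∈ monoPairs c (elements S) × c (proj₁ b) ≢ c v × CoversVertex v b
      covering-pair {v} v∉S with covers v
      ... | x , y , x<y , x∈S , y∈S , v∈ with c x ≟ c y
      ...   | yes eq = (x , y) ,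
        ∈-monoPairs⁺ c Fin.<-asym (elements-sorted S) (∈-elements⁺ x∈S) (∈-elements⁺ y∈S) x<y eq ,
        inner-adjacent _ (shortest-≤2 (g x<y x∈S y∈S) (Fin.<⇒≢ x<y) eq) v∈ (∉∈⇒≢ v∉S x∈S) (∉∈⇒≢ v∉S y∈S) ,
        v∉S , eq , x<y , x∈S , y∈S , v∈
      ...   | no neq with endpoint-of-edge _ (shortest-≤1 (g x<y x∈S y∈S) neq) v∈
      ...     | inj₁ refl = contradiction x∈S v∉S
      ...     | inj₂ refl = contradiction y∈S v∉S

      -- Outside vertices inject into the monochromatic pairs, and those of colour `i` into the
      -- pairs of other colours. Adding the `triangle (count c i ins)` pairs of colour `i` gives the
      -- condition for `i`.
      covers⇒balanced : Balanced c (elements S) (elements (∁ S))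
      covers⇒balanced =
        injection⇒length-≤ CoversVertex coversVertex-functional (elements-unique (∁ S)) _
          (λ v∈ → let b , b∈ , _ , cov = covering-pair (∈∁⇒∉ v∈) in b , b∈ , cov) ,
        λ i → begin
          count c i outs + triangle (count c i ins)
            ≤⟨ ℕ.+-monoˡ-≤ _ (colour-bound i) ⟩
          countNot (c ∘ proj₁) i (monoPairs c ins) + triangle (count c i ins)
            ≡⟨ cong (countNot (c ∘ proj₁) i (monoPairs c ins) +_) (count-monoPairs c i ins) ⟨
          countNot (c ∘ proj₁) i (monoPairs c ins) + count (c ∘ proj₁) i (monoPairs c ins)
            ≡⟨ ℕ.+-comm (countNot (c ∘ proj₁) i (monoPairs c ins)) _ ⟩
          count (c ∘ proj₁) i (monoPairs c ins) + countNot (c ∘ proj₁) i (monoPairs c ins)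
            ≡⟨ count+countNot≡length (c ∘ proj₁) i (monoPairs c ins) ⟩
          #monoPairs c ins ∎
        where
        open ℕ.≤-Reasoning
        ins outs : List (Fin n)
        ins  = elements S
        outs = elements (∁ S)
        ∈∁⇒∉ : ∀ {v} → v ∈ outs → v Subset.∉ S
        ∈∁⇒∉ v∈ = x∈∁p⇒x∉p (∈-elements⁻ (∁ S) v∈)
        colour-bound : ∀ i → count c i outs ≤ countNot (c ∘ proj₁) i (monoPairs c ins)
        colour-bound i =
          injection⇒length-≤ CoversVertex coversVertex-functional
            (Unique.filter⁺ (λ v → c v ≟ i) (elements-unique (∁ S))) _ λ v∈ →
              let v∈outs , cv≡i = ∈-filter⁻ (λ v → c v ≟ i) {xs = outs} v∈
                  b , b∈ , cb≢cv , cov = covering-pair (∈∁⇒∉ v∈outs)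
              in b , ∈-filter⁺ (λ b → ¬? (c (proj₁ b) ≟ i)) b∈ (λ cb≡i → cb≢cv (trans cb≡i (sym cv≡i))) , cov

      -- The vertex argument excludes the empty graph, where covering is vacuous.
      covers⇒2≤∣S∣ : Fin n → 2 ≤ ∣ S ∣
      covers⇒2≤∣S∣ v with x , y , x<y , x∈S , y∈S , _ ← covers v =
        subst (2 ≤_) (length-elements S)
          (injection⇒length-≤ _≡_ (λ { refl refl → refl }) ((Fin.<⇒≢ x<y ∷ []) ∷ [] ∷ []) (elements S) λ where
            (here refl)         → x , ∈-elements⁺ x∈S , refl
            (there (here refl)) → y , ∈-elements⁺ y∈S , refl)

    -- `match` assigns to each outside vertex a monochromatic pair of another colour, whose path is
    -- then routed through it. Removing the pairs of colour `i` from both sides of `parts i` yields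
    -- the condition `hall i`.
    balanced⇒covers : ∀ {S} → 2 ≤ ∣ S ∣ → Balanced c (elements S) (elements (∁ S)) →
                      Σ (Selection G S) (Covers G S)
    balanced⇒covers {S} 2≤∣S∣ (total , parts)
      with match c (c ∘ proj₁) (elements (∁ S)) (monoPairs c (elements S)) total hall
      where
      hall : ∀ i → count c i (elements (∁ S)) ≤ countNot (c ∘ proj₁) i (monoPairs c (elements S))
      hall i = ℕ.+-cancelʳ-≤ (triangle (count c i ins)) _ _ (begin
        count c i (elements (∁ S)) + triangle (count c i ins)
          ≤⟨ parts i ⟩
        #monoPairs c ins
          ≡⟨ count+countNot≡length (c ∘ proj₁) i (monoPairs c ins) ⟨
        count (c ∘ proj₁) i (monoPairs c ins) + countNot (c ∘ proj₁) i (monoPairs c ins)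
          ≡⟨ ℕ.+-comm (count (c ∘ proj₁) i (monoPairs c ins)) _ ⟩
        countNot (c ∘ proj₁) i (monoPairs c ins) + count (c ∘ proj₁) i (monoPairs c ins)
          ≡⟨ cong (countNot (c ∘ proj₁) i (monoPairs c ins) +_) (count-monoPairs c i ins) ⟩
        countNot (c ∘ proj₁) i (monoPairs c ins) + triangle (count c i ins) ∎)
        where
        open ℕ.≤-Reasoning
        ins : List (Fin n)
        ins = elements S
    ... | ms , free , ms↭outs , ms↭pairs , ds = (λ x<y _ _ → path x<y) , covers
      where
      partners! : Unique (map proj₂ ms ++ free)
      partners! = SetoidPermutation.Unique-resp-↭ (setoid _) (Permutation.↭⇒↭ₛ (↭-sym ms↭pairs))
                    (monoPairs-unique c (elements-unique S))

      -- Pairs left free by the matching still need a path; they get an arbitrary middle vertex from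
      -- `other-colour`.
      middle : ∀ b → ∃[ z ] c (proj₁ b) ≢ c z
      middle b with any? (λ (_ , b′) → ≡-dec _≟_ _≟_ b′ b) ms
      ... | no _  = other-colour (proj₁ b)
      ... | yes q with (v , _) , m∈ , refl ← find q = v , ≢-sym (All.lookup ds m∈)

      middle-matched : ∀ {v b} → (v , b) ∈ ms → proj₁ (middle b) ≡ v
      middle-matched {v} {b} m∈ with any? (λ (_ , b′) → ≡-dec _≟_ _≟_ b′ b) ms
      ... | no ¬q = contradiction (Any.map (λ { refl → refl }) m∈) ¬q
      ... | yes q with _ , m′∈ , refl ← find q = partner-unique partners! m′∈ m∈

      path : ∀ {x y} → x Fin.< y → ShortestPath G x y
      path {x} {y} x<y with c x ≟ c y
      ... | no cx≢cy  = edgePath cx≢cy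
      ... | yes cx≡cy = detour (Fin.<⇒≢ x<y) cx≡cy (proj₂ (middle (x , y)))

      middle∈path : ∀ {x y} (x<y : x Fin.< y) → c x ≡ c y →
                    proj₁ (middle (x , y)) ∈ vertices G (proj₁ (path x<y))
      middle∈path {x} {y} x<y cx≡cy with c x ≟ c y
      ... | no cx≢cy = contradiction cx≡cy cx≢cy
      ... | yes _    = there (here refl)

      covers : Covers G S (λ x<y _ _ → path x<y)
      covers v with v ∈? S
      ... | yes v∈S with w , w∈S , v≢w ← ∃-other-element S 2≤∣S∣ v with Fin.<-cmp v w
      ...   | tri< v<w _ _ = v , w , v<w , v∈S , w∈S , first∈vertices G (proj₁ (path v<w))
      ...   | tri≈ _ v≡w _ = contradiction v≡w v≢w
      ...   | tri> _ _ w<v = w , v , w<v , w∈S , v∈S , last∈vertices G (proj₁ (path w<v))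
      covers v | no v∉S
        with (_ , (x , y)) , m∈ , refl ← ∈-map⁻ proj₁ (∈-resp-↭ (↭-sym ms↭outs) (∈-elements⁺ (x∉p⇒x∈∁p v∉S)))
        with x∈ , y∈ , x<y , cx≡cy ← ∈-monoPairs⁻ c (elements-sorted S)
               (∈-resp-↭ ms↭pairs (∈-++⁺ˡ (∈-map⁺ proj₂ m∈))) =
        x , y , x<y , ∈-elements⁻ S x∈ , ∈-elements⁻ S y∈ ,
        subst (_∈ vertices G (proj₁ (path x<y))) (middle-matched m∈) (middle∈path x<y cx≡cy)

    -- `2 ≤ n` rules out the one-vertex convention and provides the vertex `zero` for
    -- `covers⇒2≤∣S∣`.
    strongGeodetic⇒feasible : 2 ≤ n → ∀ {S} → IsStrongGeodetic G S → Feasible c S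
    strongGeodetic⇒feasible (s≤s ())  (inj₁ (refl , _))
    strongGeodetic⇒feasible (s≤s 1≤n) (inj₂ (g , covers)) =
      covers⇒2≤∣S∣ g covers zero , covers⇒balanced g covers

    feasible⇒strongGeodetic : ∀ {S} → Feasible c S → IsStrongGeodetic G S
    feasible⇒strongGeodetic (2≤∣S∣ , balanced) = inj₂ (balanced⇒covers 2≤∣S∣ balanced)

-- Connectedness, graphs with at most one vertex, and the passage from parts to colours.

∃-adjacent : ∀ {n} (G : Graph n) → Connected G → 2 ≤ n → ∀ x → ∃[ z ] Adj G x z
∃-adjacent {suc (suc n)} G connected (s≤s (s≤s _)) = λ where
    zero    → first-step (λ ()) (connected zero (suc zero))
    (suc x) → first-step (λ ()) (connected (suc x) zero)
  where
  first-step : ∀ {x y} → x ≢ y → Walk G x y → ∃[ z ] Adj G x z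
  first-step x≢y ε       = contradiction refl x≢y
  first-step x≢y (e ◅ _) = _ , e

-- Without vertices the covering is vacuous; for one vertex the convention applies.
⊤-strongGeodetic : ∀ {n} (G : Graph n) → n ≤ 1 → IsStrongGeodetic G ⊤
⊤-strongGeodetic {zero}  G _         = inj₂ ((λ { {()} }) , λ ())
⊤-strongGeodetic {suc _} G (s≤s z≤n) = inj₁ (refl , refl)

∣⊤∣-minimal : ∀ {n} (G : Graph n) → n ≤ 1 → ∀ T → IsStrongGeodetic G T → ∣ ⊤ {n} ∣ ≤ ∣ T ∣
∣⊤∣-minimal {zero}  G _         T _                    = z≤n
∣⊤∣-minimal {suc _} G (s≤s z≤n) T (inj₁ (_ , refl))    = ℕ.≤-refl
∣⊤∣-minimal {suc _} G (s≤s z≤n) T (inj₂ (_ , covers)) with covers zero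
... | zero , zero , () , _

module _ {n r : ℕ} (G : Graph n) (X : Fin r → Subset n)
         (multipartite : IsCompleteMultipartite G X) (connected : Connected G) (2≤n : 2 ≤ n) where

  open IsCompleteMultipartite multipartite

  private
    part : Fin n → Fin r
    part v = proj₁ (covering v)
    ∈part : ∀ v → v Subset.∈ X (part v)
    ∈part v = proj₂ (covering v)
    part-unique : ∀ {v i} → v Subset.∈ X i → part v ≡ i
    part-unique {v} {i} v∈ = decidable-stable (part v ≟ i) λ neq →
      disjoint neq (v , x∈p∩q⁺ (∈part v , v∈))
    other-part : ∀ x → ∃[ z ] part x ≢ part z
    other-part x with z , e ← ∃-adjacent G connected 2≤n x =
      z , Equivalence.to (adjacent (∈part x) (∈part z)) e
    sg : ∀ S → Feasible part S → IsStrongGeodetic G S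
    sg S = feasible⇒strongGeodetic G part (adjacent (∈part _) (∈part _)) other-part
    sg⁻¹ : ∀ S → IsStrongGeodetic G S → Feasible part S
    sg⁻¹ S = strongGeodetic⇒feasible G part (adjacent (∈part _) (∈part _)) other-part 2≤n

  empty-or-full : ∀ S i → ¬ Split part S i → Empty (S ∩ X i) ⊎ S ∩ X i ≡ X i
  empty-or-full S i ¬split with nonempty? (S ∩ X i)
  ... | no  empty = inj₁ empty
  ... | yes (u , u∈) with u∈S , u∈X ← x∈p∩q⁻ S (X i) u∈ =
    inj₂ (⊆-antisym (p∩q⊆q S (X i)) λ {v} v∈X → x∈p∩q⁺
      (decidable-stable (v ∈? S) (λ v∉S → ¬split ((u , u∈S , part-unique u∈X) , v , v∉S , part-unique v∈X)) , v∈X))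

  optimum : ∃[ S ] (IsOptimalStrongGeodetic G S ×
                    ForAllButAtMost 2 (λ i → Empty (S ∩ X i) ⊎ S ∩ X i ≡ X i))
  optimum =
    let S , feasible , minimal , ≤2 = feasible-optimum part (⊤ , feasible-⊤ part 2≤n) in
    S , (sg S feasible , (S , sg S feasible , refl) , λ T sgT → minimal T (sg⁻¹ T sgT)) ,
    comprehension (split? part S) , ≤2 , λ i i∉ → empty-or-full S i (i∉ ∘ ∈-comprehension⁺ (split? part S))

proposition1p1 : ∀ {n r : ℕ} (G : Graph n) (X : Fin r → Subset n) →
    IsCompleteMultipartite G X →
    Connected G →
    ∃[ S ] (IsOptimalStrongGeodetic G S ×
    ForAllButAtMost 2 (λ i → Empty (S ∩ X i) ⊎ S ∩ X i ≡ X i))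
proposition1p1 {n} {r} G X multipartite connected with 2 ≤? n
-- The full vertex set meets every part in the whole part, so no index is exceptional.
... | no n<2 =
  ⊤ , (sg , (⊤ , sg , refl) , ∣⊤∣-minimal G n≤1) ,
  Subset.⊥ , subst (_≤ 2) (sym (∣⊥∣≡0 r)) z≤n , λ i _ → inj₂ (∩-identityˡ (X i))
  where
  n≤1 : n ≤ 1
  n≤1 = ℕ.s≤s⁻¹ (ℕ.≰⇒> n<2)
  sg : IsStrongGeodetic G ⊤
  sg = ⊤-strongGeodetic G n≤1
... | yes 2≤n = optimum G X multipartite connected 2≤n
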